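{- Let $h$ be a positive integer and let $S_1,\ldots,S_n$ be sets of positive integers. For each $i$ let $G_{S_i}$ denote the $\mathcal{G}$-value sequence of $\mathrm{Subtraction}(S_i)$, and suppose that there exist sequences $a_1,\ldots,a_n$ of non-negative integers such that, for every $i$, $G_{S_i}$ is the $h$-stair of $a_i$, i.e. $G_{S_i}(xh+r)=a_i(x)h+r$ for all integers $x\ge 0$ and all $r\in\{0,1,\ldots,h-1\}$. Then for every position $(x_1,\ldots,x_n)$ of the generalized cyclic Nimhoff $\mathrm{GCN}(h;S_1,\ldots,S_n)$, $$\mathcal{G}(x_1,\ldots,x_n)=\left(\bigoplus_{i=1}^n\left\lfloor \frac{G_{S_i}(x_i)}{h}\right\rfloor\right)h+\left(\sum_{i=1}^n x_i\right)\bmod h.$$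
   Context: All games are impartial two-player games under the normal play rule (the player making the last move wins). For a finite set $T\subset\mathbb{N}_0$, $\mathrm{mex}\,T=\min(\mathbb{N}_0\setminus T)$. The $\mathcal{G}$-value (Grundy value) of a position $G$ is defined recursively by $\mathcal{G}(G)=\mathrm{mex}\{\mathcal{G}(G')\mid G\to G'\}$, where $G\to G'$ means $G'$ is reachable from $G$ in one move. The nim-sum $m_1\oplus\cdots\oplus m_n$ of non-negative integers is binary addition without carry (bitwise XOR). For a set $S$ of positive integers, $\mathrm{Subtraction}(S)$ is the game played on a single heap of $x\ge 0$ tokens, where a move takes a heap of $x$ tokens to a heap of $x-s$ tokens for some $s\in S$ with $s\le x$; its $\mathcal{G}$-value sequence is $G_S(x)$, the $\mathcal{G}$-value of a heap of $x$ tokens, $x=0,1,2,\ldots$. The generalized cyclic Nimhoff $\mathrm{GCN}(h;S_1,\ldots,S_n)$ has as positions the $n$-tuples $(x_1,\ldots,x_n)$ of non-negative integers; from $(x_1,\ldots,x_n)$ the legal moves go to any $n$-tuple of non-negative integers of one of the following forms: (i) $(x_1,\ldots,x_i-s_i,\ldots,x_n)$ for some $i$ and some $s_i\in S_i$ (only coordinate $i$ changed); or (ii) $(x_1-s_1,\ldots,x_n-s_n)$ where $s_1,\ldots,s_n$ are non-negative integers with $0<\sum_{i=1}^n s_i<h$. -}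

module Defs where

open import Data.Digit using (Bit; 0b; 1b; fromDigits; toDigits)
open import Data.Fin.Base using (Fin; zero; suc)
open import Data.List.Base using (List; alignWith)
open import Data.Nat.Base using (ℕ; _+_; _*_; _∸_; _≤_; _<_)
open import Data.Nat.Properties using (≤-antisym)
open import Data.Product.Base using (_×_; _,_; ∃; ∃-syntax; proj₁)
open import Data.These.Base using (fold)
open import Data.Vec.Base using (Vec; lookup; _[_]≔_; zipWith; foldr′; sum)
open import Data.Vec.Relation.Binary.Pointwise.Inductive using (Pointwise)
open import Function.Base using (id)
open import Level using (0ℓ)
open import Relation.Binary.Core using (Rel)
open import Relation.Binary.PropositionalEquality.Core using (_≡_; refl; sym; trans)
open import Relation.Unary using (Pred; _∈_; ∁)

IsMex : Pred ℕ 0ℓ → ℕ → Set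
IsMex T m = m ∈ ∁ T × (∀ k → k ∈ ∁ T → m ≤ k)

record Game : Set₁ where
  field
    Position : Set
    _⟶_      : Rel Position 0ℓ

-- Grundy Γ p m says that 𝒢(p) = m.  It is a relation rather than a function
-- because the options of a position need not be decidable.  Being inductive,
-- it unfolds the recursive definition of 𝒢: every option p′ of p has a value
-- v p′, and m is the mex of these values.

data Grundy (Γ : Game) (p : Game.Position Γ) (m : ℕ) : Set where
  grundy : let open Game Γ in
           (v : ∀ p′ → p ⟶ p′ → ℕ) →
           (∀ p′ (t : p ⟶ p′) → Grundy Γ p′ (v p′ t)) →
           IsMex (λ k → ∃[ p′ ] ∃[ t ] v p′ t ≡ k) m →
           Grundy Γ p m

Grundy-unique : ∀ {Γ p m m′} → Grundy Γ p m → Grundy Γ p m′ → m ≡ m′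
Grundy-unique (grundy v gs (m∉ , m-min)) (grundy v′ gs′ (m′∉ , m′-min)) =
  ≤-antisym
    (m-min _ λ (p′ , t , eq) →
      m′∉ (p′ , t , trans (sym (Grundy-unique (gs p′ t) (gs′ p′ t))) eq))
    (m′-min _ λ (p′ , t , eq) →
      m∉ (p′ , t , trans (Grundy-unique (gs p′ t) (gs′ p′ t)) eq))

Subtraction : Pred ℕ 0ℓ → Game
Subtraction S = record
  { Position = ℕ
  ; _⟶_      = λ x y → ∃[ s ] (s ∈ S × s ≤ x × y ≡ x ∸ s)
  }

module _ {n : ℕ} (h : ℕ) (S : Fin n → Pred ℕ 0ℓ) where

  data GCNMove (x y : Vec ℕ n) : Set where
    single : ∀ i s → s ∈ S i → s ≤ lookup x i →
             y ≡ x [ i ]≔ (lookup x i ∸ s) → GCNMove x y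
    cyclic : ∀ (s : Vec ℕ n) → 0 < sum s → sum s < h → Pointwise _≤_ s x →
             y ≡ zipWith _∸_ x s → GCNMove x y

  GCN : Game
  GCN = record { Position = Vec ℕ n ; _⟶_ = GCNMove }

IsStair : (h : ℕ) (a G : ℕ → ℕ) → Set
IsStair h a G = ∀ x r → r < h → G (x * h + r) ≡ a x * h + r

infixl 6 _⊕ᵇ_ _⊕_

_⊕ᵇ_ : Bit → Bit → Bit
zero     ⊕ᵇ b        = b
suc zero ⊕ᵇ zero     = 1b
suc zero ⊕ᵇ suc zero = 0b

-- Digit lists start with the least significant bit, so they are aligned at
-- that end; the excess digits of the longer list are kept.

_⊕_ : ℕ → ℕ → ℕ
m ⊕ n = fromDigits (alignWith (fold id id _⊕ᵇ_) (bits m) (bits n))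
  where
  bits : ℕ → List Bit
  bits k = proj₁ (toDigits 2 k)

⨁ : ∀ {n} → Vec ℕ n → ℕ
⨁ = foldr′ _⊕_ 0

{-# OPTIONS --safe #-}
module Submission where

open import Defs
open import Data.Digit using (Bit; 0b; 1b; fromDigits; toDigits)
open import Data.Fin.Base using (Fin; zero; suc; toℕ)
open import Data.List.Base using (List; []; _∷_; alignWith)
open import Data.List.Properties using (map-id)
open import Data.Nat.Base
  using (ℕ; zero; suc; _+_; _*_; _∸_; _≤_; _<_; _/_; _%_; _⊓_; pred; NonZero; z≤n; s≤s; z<s)
open import Data.Nat.DivMod
open import Data.Nat.Divisibility using (n∣m*n)
open import Data.Nat.Induction using (<-wellFounded)
open import Data.Nat.Properties
open import Algebra.Properties.CommutativeSemigroup +-commutativeSemigroup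
  using (interchange; xy∙z≈xz∙y; x∙yz≈y∙xz)
open import Data.Product.Base using (_×_; _,_; ∃; ∃-syntax; ∃₂; proj₁; proj₂)
open import Data.Sum.Base as Sum using (_⊎_; inj₁; inj₂)
open import Data.These.Base using (fold)
open import Data.Vec.Base as Vec using (Vec; []; _∷_; lookup; tabulate; sum; _[_]≔_; zipWith)
open import Data.Vec.Properties using (lookup∘tabulate; tabulate-cong; lookup-zipWith; lookup-map)
open import Data.Vec.Relation.Binary.Pointwise.Inductive as Pointwise using (Pointwise; []; _∷_)
open import Data.Vec.Relation.Binary.Pointwise.Extensional using (ext; extensional⇒inductive)
open import Function.Base using (id; _∘_; flip)
open import Induction.WellFounded using (Acc; acc; WellFounded; module Subrelation)
open import Level using (0ℓ)
open import Relation.Binary.Construct.On using () renaming (wellFounded to on-wellFounded)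
open import Relation.Binary.Definitions using (tri<; tri≈; tri>)
open import Relation.Binary.PropositionalEquality
open import Relation.Nullary using (¬_; contradiction)
open import Relation.Unary using (Pred; _∈_)

-- Let V be the claimed value.  The stair hypothesis makes x and G i x congruent
-- modulo h, and makes G i x / h depend on x / h only.  A cyclic move changes the sum
-- modulo h.  A single move preserving V would preserve both G i / h and the residue
-- of heap i, hence G i itself.  Conversely, let k < V x.  If k / h is smaller than the
-- nim-sum of the quotients, Nim provides a heap i and a smaller quotient b; the
-- residue e needed for the sum is then free, because b * h + e < G i (x i) and so a
-- move of heap i attains this value.  Otherwise only the residue of the sum has to
-- drop, and a cyclic move taking tokens from the residues of the heaps does it.

-- Binary digits of natural numbers

infixr 5 _∷₂_

_∷₂_ : Bit → ℕ → ℕ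
b ∷₂ n = toℕ b + n * 2

∷₂-injective : ∀ b c {m n} → b ∷₂ m ≡ c ∷₂ n → b ≡ c × m ≡ n
∷₂-injective zero       zero       {m} {n} eq = refl , *-cancelʳ-≡ m n 2 eq
∷₂-injective zero       (suc zero) {m} {n} eq =
  contradiction (trans (*-comm 2 m) (trans eq (cong suc (*-comm n 2)))) (even≢odd m n)
∷₂-injective (suc zero) zero       {m} {n} eq =
  contradiction (trans (*-comm 2 n) (trans (sym eq) (cong suc (*-comm m 2)))) (even≢odd n m)
∷₂-injective (suc zero) (suc zero) {m} {n} eq = refl , *-cancelʳ-≡ m n 2 (suc-injective eq)

val : List Bit → ℕ
val = fromDigits

expansion : ∀ n → ∃[ ds ] n ≡ val ds
expansion n with ds , eq ← toDigits 2 n = ds , sym eq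

-- The recursion runs on a digit list, because `n` need not be smaller than `b ∷₂ n`: `0b ∷₂ 0` is
-- `0` again.
∷₂-ind : (P : Pred ℕ 0ℓ) → P 0 → (∀ b n → P n → P (b ∷₂ n)) → ∀ n → P n
∷₂-ind P base step n with ds , refl ← expansion n = go ds
  where
  go : ∀ ds → P (val ds)
  go []       = base
  go (d ∷ ds) = step d _ (go ds)

∷₂-view : ∀ n → ∃₂ λ b m → n ≡ b ∷₂ m
∷₂-view n with expansion n
... | []     , refl = 0b , 0 , refl
... | d ∷ ds , refl = d , val ds , refl

∷₂-mono-< : ∀ b c {m n} → m < n → b ∷₂ m < c ∷₂ n
∷₂-mono-< b c {m} {n} m<n = begin-strict
  toℕ b + m * 2  <⟨ +-monoˡ-< (m * 2) (toℕ<2 b) ⟩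
  suc m * 2      ≤⟨ *-monoˡ-≤ 2 m<n ⟩
  n * 2          ≤⟨ m≤n+m (n * 2) (toℕ c) ⟩
  toℕ c + n * 2  ∎
  where
  open ≤-Reasoning
  toℕ<2 : ∀ (d : Bit) → toℕ d < 2
  toℕ<2 zero       = z<s
  toℕ<2 (suc zero) = s≤s z<s

∷₂-<-split : ∀ b c {m n} → b ∷₂ m < c ∷₂ n → m < n ⊎ (m ≡ n × b ≡ 0b × c ≡ 1b)
∷₂-<-split b c {m} {n} lt with <-cmp m n
... | tri< m<n _ _    = inj₁ m<n
... | tri≈ _ refl _   = inj₂ (refl , bits b c (+-cancelʳ-< (m * 2) (toℕ b) (toℕ c) lt))
  where
  bits : ∀ (b c : Bit) → toℕ b < toℕ c → b ≡ 0b × c ≡ 1b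
  bits zero       (suc zero) _       = refl , refl
  bits (suc zero) (suc zero) (s≤s ())
... | tri> _ _ n<m    = contradiction lt (<-asym (∷₂-mono-< c b n<m))

-- Nim-sum on digit lists

xorDigits : List Bit → List Bit → List Bit
xorDigits = alignWith (fold id id _⊕ᵇ_)

⊕ᵇ-identityʳ : ∀ b → b ⊕ᵇ 0b ≡ b
⊕ᵇ-identityʳ zero       = refl
⊕ᵇ-identityʳ (suc zero) = refl

⊕ᵇ-comm : ∀ b c → b ⊕ᵇ c ≡ c ⊕ᵇ b
⊕ᵇ-comm zero       zero       = refl
⊕ᵇ-comm zero       (suc zero) = refl
⊕ᵇ-comm (suc zero) zero       = refl
⊕ᵇ-comm (suc zero) (suc zero) = refl

⊕ᵇ-assoc : ∀ b c d → b ⊕ᵇ c ⊕ᵇ d ≡ b ⊕ᵇ (c ⊕ᵇ d)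
⊕ᵇ-assoc zero       c          d          = refl
⊕ᵇ-assoc (suc zero) zero       d          = refl
⊕ᵇ-assoc (suc zero) (suc zero) zero       = refl
⊕ᵇ-assoc (suc zero) (suc zero) (suc zero) = refl

⊕ᵇ-self : ∀ b → b ⊕ᵇ b ≡ 0b
⊕ᵇ-self zero       = refl
⊕ᵇ-self (suc zero) = refl

xorDigits-comm : ∀ xs ys → xorDigits xs ys ≡ xorDigits ys xs
xorDigits-comm []       []       = refl
xorDigits-comm []       (y ∷ ys) = refl
xorDigits-comm (x ∷ xs) []       = refl
xorDigits-comm (x ∷ xs) (y ∷ ys) = cong₂ _∷_ (⊕ᵇ-comm x y) (xorDigits-comm xs ys)

xorDigits-zeroˡ : ∀ xs ys → val xs ≡ 0 → val (xorDigits xs ys) ≡ val ys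
xorDigits-zeroˡ []       ys       eq = cong val (map-id ys)
xorDigits-zeroˡ (x ∷ xs) []       eq = trans (cong val (map-id (x ∷ xs))) eq
-- `0` is read as `0b ∷₂ 0`, so injectivity forces the lowest digit to be `0b`.
xorDigits-zeroˡ (x ∷ xs) (y ∷ ys) eq with refl , eq′ ← ∷₂-injective x 0b {val xs} {0} eq =
  cong (y ∷₂_) (xorDigits-zeroˡ xs ys eq′)

-- Expansions of a number differ by leading zeros, which the xor does not see.
xorDigits-congˡ : ∀ xs xs′ ys → val xs ≡ val xs′ →
                  val (xorDigits xs ys) ≡ val (xorDigits xs′ ys)
xorDigits-congˡ []       xs′        ys       eq =
  trans (xorDigits-zeroˡ [] ys refl) (sym (xorDigits-zeroˡ xs′ ys (sym eq)))
xorDigits-congˡ (x ∷ xs) []         ys       eq =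
  trans (xorDigits-zeroˡ (x ∷ xs) ys eq) (sym (xorDigits-zeroˡ [] ys refl))
xorDigits-congˡ (x ∷ xs) (x′ ∷ xs′) []       eq
  rewrite map-id xs | map-id xs′ = eq
xorDigits-congˡ (x ∷ xs) (x′ ∷ xs′) (y ∷ ys) eq
  with refl , eq′ ← ∷₂-injective x x′ {val xs} {val xs′} eq =
  cong ((x ⊕ᵇ y) ∷₂_) (xorDigits-congˡ xs xs′ ys eq′)

xorDigits-congʳ : ∀ xs ys ys′ → val ys ≡ val ys′ →
                  val (xorDigits xs ys) ≡ val (xorDigits xs ys′)
xorDigits-congʳ xs ys ys′ eq
  rewrite xorDigits-comm xs ys | xorDigits-comm xs ys′ = xorDigits-congˡ ys ys′ xs eq

-- Frees `_⊕_` from the particular expansions chosen by `toDigits`.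
⊕-val : ∀ xs ys → val xs ⊕ val ys ≡ val (xorDigits xs ys)
⊕-val xs ys =
  trans (xorDigits-congˡ xs′ xs ys′ (proj₂ (toDigits 2 (val xs))))
        (xorDigits-congʳ xs ys′ ys (proj₂ (toDigits 2 (val ys))))
  where
  xs′ ys′ : List Bit
  xs′ = proj₁ (toDigits 2 (val xs))
  ys′ = proj₁ (toDigits 2 (val ys))

⊕-∷₂ : ∀ b c m n → (b ∷₂ m) ⊕ (c ∷₂ n) ≡ (b ⊕ᵇ c) ∷₂ (m ⊕ n)
⊕-∷₂ b c m n with xs , refl ← expansion m | ys , refl ← expansion n =
  trans (⊕-val (b ∷ xs) (c ∷ ys)) (cong ((b ⊕ᵇ c) ∷₂_) (sym (⊕-val xs ys)))

-- Nim-addition and the strategy of Nim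

-- The recurrence ⊕-∷₂ characterises nim-addition, so _⊕_ itself, which unfolds to
-- large terms, is kept out of the algebra.
module NimSum
  (xor : ℕ → ℕ → ℕ)
  (0⊞0≡0 : xor 0 0 ≡ 0)
  (⊞-∷₂ : ∀ b c m n → xor (b ∷₂ m) (c ∷₂ n) ≡ (b ⊕ᵇ c) ∷₂ xor m n)
  where

  infixl 6 _⊞_

  _⊞_ : ℕ → ℕ → ℕ
  _⊞_ = xor

  ⨁′ : ∀ {n} → Vec ℕ n → ℕ
  ⨁′ = Vec.foldr′ _⊞_ 0

  ⊞-identityˡ : ∀ n → 0 ⊞ n ≡ n
  ⊞-identityˡ = ∷₂-ind _ 0⊞0≡0 λ b n ih → trans (⊞-∷₂ 0b b 0 n) (cong (b ∷₂_) ih)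

  ⊞-identityʳ : ∀ n → n ⊞ 0 ≡ n
  ⊞-identityʳ = ∷₂-ind _ 0⊞0≡0 λ b n ih →
    trans (⊞-∷₂ b 0b n 0) (cong₂ _∷₂_ (⊕ᵇ-identityʳ b) ih)

  ⊞-self : ∀ n → n ⊞ n ≡ 0
  ⊞-self = ∷₂-ind _ 0⊞0≡0 λ b n ih → trans (⊞-∷₂ b b n n) (cong₂ _∷₂_ (⊕ᵇ-self b) ih)

  ⊞-comm : ∀ m n → m ⊞ n ≡ n ⊞ m
  ⊞-comm = ∷₂-ind _ (λ n → trans (⊞-identityˡ n) (sym (⊞-identityʳ n))) step
    where
    step : ∀ b m → (∀ n → m ⊞ n ≡ n ⊞ m) → ∀ n → (b ∷₂ m) ⊞ n ≡ n ⊞ (b ∷₂ m)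
    step b m ih n with c , n′ , refl ← ∷₂-view n =
      trans (⊞-∷₂ b c m n′) (trans (cong₂ _∷₂_ (⊕ᵇ-comm b c) (ih n′)) (sym (⊞-∷₂ c b n′ m)))

  ⊞-assoc : ∀ m n k → m ⊞ n ⊞ k ≡ m ⊞ (n ⊞ k)
  ⊞-assoc = ∷₂-ind _
    (λ n k → trans (cong (_⊞ k) (⊞-identityˡ n)) (sym (⊞-identityˡ (n ⊞ k)))) step
    where
    open ≡-Reasoning
    step : ∀ b m → (∀ n k → m ⊞ n ⊞ k ≡ m ⊞ (n ⊞ k)) →
           ∀ n k → (b ∷₂ m) ⊞ n ⊞ k ≡ (b ∷₂ m) ⊞ (n ⊞ k)
    step b m ih n k with c , n′ , refl ← ∷₂-view n | d , k′ , refl ← ∷₂-view k = begin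
      (b ∷₂ m) ⊞ (c ∷₂ n′) ⊞ (d ∷₂ k′)    ≡⟨ cong (_⊞ (d ∷₂ k′)) (⊞-∷₂ b c m n′) ⟩
      ((b ⊕ᵇ c) ∷₂ m ⊞ n′) ⊞ (d ∷₂ k′)    ≡⟨ ⊞-∷₂ (b ⊕ᵇ c) d (m ⊞ n′) k′ ⟩
      (b ⊕ᵇ c ⊕ᵇ d) ∷₂ (m ⊞ n′ ⊞ k′)      ≡⟨ cong₂ _∷₂_ (⊕ᵇ-assoc b c d) (ih n′ k′) ⟩
      (b ⊕ᵇ (c ⊕ᵇ d)) ∷₂ (m ⊞ (n′ ⊞ k′))  ≡⟨ ⊞-∷₂ b (c ⊕ᵇ d) m (n′ ⊞ k′) ⟨
      (b ∷₂ m) ⊞ ((c ⊕ᵇ d) ∷₂ n′ ⊞ k′)    ≡⟨ cong ((b ∷₂ m) ⊞_) (⊞-∷₂ c d n′ k′) ⟨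
      (b ∷₂ m) ⊞ ((c ∷₂ n′) ⊞ (d ∷₂ k′))  ∎

  ⊞-involutiveʳ : ∀ m n → m ⊞ n ⊞ n ≡ m
  ⊞-involutiveʳ m n = trans (⊞-assoc m n n) (trans (cong (m ⊞_) (⊞-self n)) (⊞-identityʳ m))

  ⊞-cancelʳ : ∀ k m n → m ⊞ k ≡ n ⊞ k → m ≡ n
  ⊞-cancelʳ k m n eq =
    trans (sym (⊞-involutiveʳ m k)) (trans (cong (_⊞ k) eq) (⊞-involutiveʳ n k))

  ⊞-cancelˡ : ∀ k m n → k ⊞ m ≡ k ⊞ n → m ≡ n
  ⊞-cancelˡ k m n eq = ⊞-cancelʳ k m n (trans (⊞-comm m k) (trans eq (⊞-comm k n)))

  -- At the highest digit where `k` and `m ⊞ n` differ, `m ⊞ n` has a 1, so exactly one of `m` and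
  -- `n` has a 1 there. Replacing that number by the nim-sum of `k` and the other one clears this
  -- digit and keeps all higher ones.
  ⊞-option : ∀ k m n → k < m ⊞ n → k ⊞ n < m ⊎ k ⊞ m < n
  ⊞-option = ∷₂-ind _ base step
    where
    base : ∀ m n → 0 < m ⊞ n → 0 ⊞ n < m ⊎ 0 ⊞ m < n
    -- Here `m` and `n` differ, and the larger one is lowered to the smaller.
    base m n lt rewrite ⊞-identityˡ m | ⊞-identityˡ n with <-cmp m n
    ... | tri< m<n _ _  = inj₂ m<n
    ... | tri≈ _ refl _ = contradiction (sym (⊞-self m)) (<⇒≢ lt)
    ... | tri> _ _ n<m  = inj₁ n<m

    step : ∀ d k → (∀ m n → k < m ⊞ n → k ⊞ n < m ⊎ k ⊞ m < n) →
           ∀ m n → d ∷₂ k < m ⊞ n → (d ∷₂ k) ⊞ n < m ⊎ (d ∷₂ k) ⊞ m < n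
    step d k ih m n lt
      with b , m′ , refl ← ∷₂-view m | c , n′ , refl ← ∷₂-view n
      rewrite ⊞-∷₂ b c m′ n′ | ⊞-∷₂ d c k n′ | ⊞-∷₂ d b k m′
      with ∷₂-<-split d (b ⊕ᵇ c) lt
    ... | inj₁ lt′ = Sum.map (∷₂-mono-< (d ⊕ᵇ c) b) (∷₂-mono-< (d ⊕ᵇ b) c) (ih m′ n′ lt′)
    -- The lowest digit is the only difference, and the number whose lowest bit is 1 drops by
    -- exactly 1.
    ... | inj₂ (refl , refl , bc≡1) = top b c bc≡1
      where
      top : ∀ b c → b ⊕ᵇ c ≡ 1b →
            c ∷₂ (m′ ⊞ n′ ⊞ n′) < b ∷₂ m′ ⊎ b ∷₂ (m′ ⊞ n′ ⊞ m′) < c ∷₂ n′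
      top zero       (suc zero) _ rewrite ⊞-comm m′ n′ | ⊞-involutiveʳ n′ m′ = inj₂ ≤-refl
      top (suc zero) (suc zero) ()
      top (suc zero) zero       _ rewrite ⊞-involutiveʳ m′ n′ = inj₁ ≤-refl

  -- The tail acts as a single heap of size `⨁′ v`; if that heap is the one to shrink, its new size
  -- `k ⊞ m` is the target of the recursive call.
  ⨁-option : ∀ {n} (v : Vec ℕ n) {k} → k < ⨁′ v →
             ∃₂ λ i b → b < lookup v i × ⨁′ (v [ i ]≔ b) ≡ k
  ⨁-option (m ∷ v) {k} lt with ⊞-option k m (⨁′ v) lt
  ... | inj₁ p = zero , k ⊞ ⨁′ v , p , ⊞-involutiveʳ k (⨁′ v)
  ... | inj₂ p with i , b , b< , eq ← ⨁-option v p =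
    suc i , b , b< , trans (cong (m ⊞_) eq) (trans (⊞-comm m (k ⊞ m)) (⊞-involutiveʳ k m))

  ⨁-update-injective : ∀ {n} (v : Vec ℕ n) i {b} → ⨁′ (v [ i ]≔ b) ≡ ⨁′ v → b ≡ lookup v i
  ⨁-update-injective (m ∷ v) zero    {b} eq = ⊞-cancelʳ (⨁′ v) b m eq
  ⨁-update-injective (m ∷ v) (suc i)     eq = ⨁-update-injective v i (⊞-cancelˡ m _ _ eq)

open NimSum _⊕_ refl ⊕-∷₂ using (⨁-option; ⨁-update-injective)

-- Sums over vectors

sum-update : ∀ {n} (x : Vec ℕ n) i y → sum (x [ i ]≔ y) + lookup x i ≡ sum x + y
sum-update (x₀ ∷ x) zero    y = trans (+-comm (y + sum x) x₀)
  (trans (x∙yz≈y∙xz x₀ y (sum x)) (+-comm y (x₀ + sum x)))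
sum-update (x₀ ∷ x) (suc i) y = trans (+-assoc x₀ _ _)
  (trans (cong (x₀ +_) (sum-update x i y)) (sym (+-assoc x₀ _ _)))

sum-∸ : ∀ {n} {x s : Vec ℕ n} → Pointwise _≤_ s x → sum (zipWith _∸_ x s) + sum s ≡ sum x
sum-∸ []       = refl
sum-∸ {x = x ∷ xs} {s ∷ ss} (p ∷ ps) =
  trans (interchange (x ∸ s) _ s _) (cong₂ _+_ (m∸n+n≡m p) (sum-∸ ps))

-- Greedy choice: the first entry gives `m ⊓ t`, and the others supply the remaining `t ∸ m`.
sum-choose : ∀ {n} (r : Vec ℕ n) t → t ≤ sum r →
             ∃ λ (s : Vec ℕ n) → Pointwise _≤_ s r × sum s ≡ t
sum-choose []      zero z≤n = [] , [] , refl
sum-choose (m ∷ r) t    t≤ with s , s≤r , eq ← sum-choose r (t ∸ m) (m≤n+o⇒m∸n≤o t m t≤) =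
  m ⊓ t ∷ s , m⊓n≤m m t ∷ s≤r , trans (cong (m ⊓ t +_) eq) (m⊓n+n∸m≡n m t)

tabulate-update : ∀ {n} (f : Fin n → ℕ → ℕ) (x : Vec ℕ n) i y →
                  tabulate (λ j → f j (lookup (x [ i ]≔ y) j)) ≡
                  tabulate (λ j → f j (lookup x j)) [ i ]≔ f i y
tabulate-update f (x₀ ∷ x) zero    y = refl
tabulate-update f (x₀ ∷ x) (suc i) y = cong (f zero x₀ ∷_) (tabulate-update (f ∘ suc) x i y)

-- Arithmetic modulo `h` and stairs

module _ (h : ℕ) .{{_ : NonZero h}} where

  %-cong-+ : ∀ m n k → m % h ≡ n % h → (m + k) % h ≡ (n + k) % h
  %-cong-+ m n k eq = trans (%-distribˡ-+ m k h)
    (trans (cong (λ j → (j + k % h) % h) eq) (sym (%-distribˡ-+ n k h)))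

  -- Modulo h, k * pred h is the negative of k.
  %-negate : ∀ m k → (m + k + k * pred h) % h ≡ m % h
  %-negate m k = trans (cong (_% h) eq) ([m+kn]%n≡m%n m k h)
    where
    eq : m + k + k * pred h ≡ m + k * h
    eq = trans (+-assoc m k _) (cong (m +_)
           (trans (sym (*-suc k (pred h))) (cong (k *_) (suc-pred h))))

  %-cancel-+ : ∀ m n k → (m + k) % h ≡ (n + k) % h → m % h ≡ n % h
  %-cancel-+ m n k eq = trans (sym (%-negate m k))
    (trans (%-cong-+ (m + k) (n + k) (k * pred h) eq) (%-negate n k))

  %-subtract : ∀ m k → ∃[ e ] (e < h × (k + e) % h ≡ m % h)
  %-subtract m k = e , m%n<n _ h ,
    trans (cong (_% h) (+-comm k e)) (trans (%-cong-+ e j k (m%n%n≡m%n j h))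
      (trans (cong (_% h) (xy∙z≈xz∙y m (k * pred h) k)) (%-negate m k)))
    where
    j e : ℕ
    -- `j` stands for the difference of `m` and `k` modulo `h`, free of truncation.
    j = m + k * pred h
    e = j % h

  [qh+r]%h : ∀ q {r} → r < h → (q * h + r) % h ≡ r
  [qh+r]%h q {r} r<h = trans (%-remove-+ˡ r (n∣m*n q)) (m<n⇒m%n≡m r<h)

  [qh+r]/h : ∀ q {r} → r < h → (q * h + r) / h ≡ q
  [qh+r]/h q {r} r<h = trans (+-distrib-/-∣ˡ r (n∣m*n q))
    (trans (cong₂ _+_ (m*n/n≡m q h) (m<n⇒m/n≡0 r<h)) (+-identityʳ q))

  divMod-split : ∀ x → x ≡ x / h * h + x % h
  divMod-split x = trans (m≡m%n+[m/n]*n x h) (+-comm (x % h) _)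

  divMod-injective : ∀ {x y} → x / h ≡ y / h → x % h ≡ y % h → x ≡ y
  divMod-injective {x} {y} q≡ r≡ =
    trans (divMod-split x) (trans (cong₂ (λ q r → q * h + r) q≡ r≡) (sym (divMod-split y)))

  /-remainder-∸ : ∀ x {s} → s ≤ x % h → (x ∸ s) / h ≡ x / h
  /-remainder-∸ x {s} s≤ = trans (cong (_/ h) eq)
    ([qh+r]/h (x / h) (≤-<-trans (m∸n≤m (x % h) s) (m%n<n x h)))
    where
    eq : x ∸ s ≡ x / h * h + (x % h ∸ s)
    eq = trans (cong (_∸ s) (divMod-split x)) (+-∸-assoc (x / h * h) s≤)

  -- The order is lexicographic in quotient and remainder. The two outcomes become the single and
  -- the cyclic moves of `V-reach`.
  <-divMod-split : ∀ q {r k} → r < h → k < q * h + r → k / h < q ⊎ (k / h ≡ q × k % h < r)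
  <-divMod-split q {r} {k} r<h lt
    with m≤n⇒m<n∨m≡n (subst (k / h ≤_) ([qh+r]/h q r<h) (/-monoˡ-≤ h (<⇒≤ lt)))
  ... | inj₁ k/h<q = inj₁ k/h<q
  ... | inj₂ refl  = inj₂
    (refl , +-cancelˡ-< (k / h * h) (k % h) r (subst (_< k / h * h + r) (divMod-split k) lt))

  -- Both sums are congruent modulo `h`, and a remainder is at most the number it comes from. Hence
  -- the residues hold enough tokens for the cyclic move.
  sum-%-≤ : ∀ {n} (x : Vec ℕ n) → sum x % h ≤ sum (Vec.map (_% h) x)
  sum-%-≤ x = subst (_≤ sum (Vec.map (_% h) x)) (sym (same x)) (m%n≤m _ h)
    where
    same : ∀ {n} (x : Vec ℕ n) → sum x % h ≡ sum (Vec.map (_% h) x) % h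
    same []       = refl
    same (x₀ ∷ x) = trans (%-distribˡ-+ x₀ (sum x) h)
      (trans (cong (λ j → (x₀ % h + j) % h) (same x))
        (trans (cong (λ j → (j + sum′ % h) % h) (sym (m%n%n≡m%n x₀ h)))
          (sym (%-distribˡ-+ (x₀ % h) sum′ h))))
      where sum′ = sum (Vec.map (_% h) x)

  module _ (a G : ℕ → ℕ) (stair : IsStair h a G) where

    stair-split : ∀ x → G x ≡ a (x / h) * h + x % h
    stair-split x = trans (cong G (divMod-split x)) (stair (x / h) (x % h) (m%n<n x h))

    stair-/ : ∀ x → G x / h ≡ a (x / h)
    stair-/ x = trans (cong (_/ h) (stair-split x)) ([qh+r]/h (a (x / h)) (m%n<n x h))

    stair-% : ∀ x → G x % h ≡ x % h
    stair-% x = trans (cong (_% h) (stair-split x)) ([qh+r]%h (a (x / h)) (m%n<n x h))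

    stair-remainder-∸ : ∀ x {s} → s ≤ x % h → G (x ∸ s) / h ≡ G x / h
    stair-remainder-∸ x s≤ = trans (stair-/ _)
      (trans (cong a (/-remainder-∸ x s≤)) (sym (stair-/ x)))

-- Characterising Grundy values

module _ {Γ : Game} (v : Game.Position Γ → ℕ) where
  open Game Γ

  -- Reachability up to double negation suffices: minimality in `IsMex` already assumes that `k` is
  -- not attained, so `k < v p` is refuted, and this gives `v p ≤ k`.
  grundy-intro : WellFounded (flip _⟶_) →
                 (∀ {p q} → p ⟶ q → v q ≢ v p) →
                 (∀ p {k} → k < v p → ¬ ¬ (∃[ q ] (p ⟶ q × v q ≡ k))) →
                 ∀ p → Grundy Γ p (v p)
  grundy-intro wf v≢ reach p = go p (wf p)
    where
    go : ∀ p → Acc (flip _⟶_) p → Grundy Γ p (v p)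
    go p (acc rs) = grundy (λ q _ → v q) (λ q t → go q (rs t))
      ( (λ (q , t , eq) → v≢ t eq)
      , (λ k unreached → ≮⇒≥ λ k<v → reach p k<v unreached) )

  module _ (isGrundy : ∀ p → Grundy Γ p (v p)) where

    grundy-≢ : ∀ {p q} → p ⟶ q → v q ≢ v p
    grundy-≢ {p} {q} t eq with grundy w gs (∉ , _) ← isGrundy p =
      ∉ (q , t , trans (Grundy-unique (gs q t) (isGrundy q)) eq)

    -- Moves need not be decidable, so an option exists only up to double negation.
    grundy-reach : ∀ p {k} → k < v p → ¬ ¬ (∃[ q ] (p ⟶ q × v q ≡ k))
    grundy-reach p {k} k<v none with grundy w gs (_ , least) ← isGrundy p =
      <⇒≱ k<v (least k λ (q , t , eq) →
        none (q , t , trans (Grundy-unique (isGrundy q) (gs q t)) eq))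

-- Values of generalized cyclic Nimhoff

theorem2p1 : ∀ (h : ℕ) .{{_ : NonZero h}} (n : ℕ) (S : Fin n → Pred ℕ 0ℓ) →
    (∀ i s → s ∈ S i → 0 < s) →
    (G : Fin n → ℕ → ℕ) →
    (∀ i x → Grundy (Subtraction (S i)) x (G i x)) →
    (a : Fin n → ℕ → ℕ) →
    (∀ i → IsStair h (a i) (G i)) →
    (x : Vec ℕ n) →
    Grundy (GCN h S) x (⨁ (tabulate (λ i → G i (lookup x i) / h)) * h + sum x % h)
theorem2p1 h n S S-pos G G-grundy a stair = grundy-intro V wf V-≢ V-reach
  where
  open Game (GCN h S) using (_⟶_)

  A : Vec ℕ n → Vec ℕ n
  A x = tabulate λ i → G i (lookup x i) / h

  V : Vec ℕ n → ℕ
  V x = ⨁ (A x) * h + sum x % h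

  V-/ : ∀ x → V x / h ≡ ⨁ (A x)
  V-/ x = [qh+r]/h h (⨁ (A x)) (m%n<n (sum x) h)

  V-% : ∀ x → V x % h ≡ sum x % h
  V-% x = [qh+r]%h h (⨁ (A x)) (m%n<n (sum x) h)

  A-update : ∀ x i y → A (x [ i ]≔ y) ≡ A x [ i ]≔ (G i y / h)
  A-update = tabulate-update λ i y → G i y / h

  sum-decreasing : ∀ {x y} → x ⟶ y → sum y < sum x
  sum-decreasing {x} (single i s s∈S s≤ refl) = +-cancelʳ-< (lookup x i) _ _ (begin-strict
    sum (x [ i ]≔ (lookup x i ∸ s)) + lookup x i  ≡⟨ sum-update x i _ ⟩
    sum x + (lookup x i ∸ s)  <⟨ +-monoʳ-< (sum x) (∸-monoʳ-< (S-pos i s s∈S) s≤) ⟩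
    sum x + lookup x i        ∎)
    where open ≤-Reasoning
  sum-decreasing {x} (cyclic s 0<s _ s≤x refl) =
    subst (sum (zipWith _∸_ x s) <_) (sum-∸ s≤x) (m<m+n _ 0<s)

  wf : WellFounded (flip _⟶_)
  wf = Subrelation.wellFounded sum-decreasing (on-wellFounded sum <-wellFounded)

  V-≢ : ∀ {x y} → x ⟶ y → V y ≢ V x
  V-≢ {x} (single i s s∈S s≤ refl) eq =
    grundy-≢ (G i) (G-grundy i) {xᵢ} (s , s∈S , s≤ , refl) (divMod-injective h /-eq %-eq)
    where
    xᵢ yᵢ : ℕ
    xᵢ = lookup x i
    yᵢ = xᵢ ∸ s
    y : Vec ℕ n
    y = x [ i ]≔ yᵢ

    /-eq : G i yᵢ / h ≡ G i xᵢ / h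
    -- Equal values have equal nim-sums of quotients, and cancelling the unchanged heaps leaves the
    -- quotients of heap `i`.
    /-eq = trans
      (⨁-update-injective (A x) i (trans (cong ⨁ (sym (A-update x i yᵢ)))
        (trans (sym (V-/ y)) (trans (cong (_/ h) eq) (V-/ x)))))
      (lookup∘tabulate _ i)

    sum-%-eq : sum y % h ≡ sum x % h
    sum-%-eq = trans (sym (V-% y)) (trans (cong (_% h) eq) (V-% x))

    %-eq : G i yᵢ % h ≡ G i xᵢ % h
    %-eq = trans (stair-% h (a i) (G i) (stair i) yᵢ) (trans
      (%-cancel-+ h yᵢ xᵢ (sum x) (begin
        (yᵢ + sum x) % h  ≡⟨ cong (_% h) (+-comm yᵢ (sum x)) ⟩
        (sum x + yᵢ) % h  ≡⟨ cong (_% h) (sum-update x i yᵢ) ⟨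
        (sum y + xᵢ) % h  ≡⟨ %-cong-+ h (sum y) (sum x) xᵢ sum-%-eq ⟩
        (sum x + xᵢ) % h  ≡⟨ cong (_% h) (+-comm (sum x) xᵢ) ⟩
        (xᵢ + sum x) % h  ∎))
      (sym (stair-% h (a i) (G i) (stair i) xᵢ)))
      where open ≡-Reasoning
  -- Equal values would make `sum s` vanish modulo `h`, although it lies strictly between 0 and `h`.
  V-≢ {x} (cyclic s 0<s s<h s≤x refl) eq = <⇒≢ 0<s (sym (begin
    sum s      ≡⟨ m<n⇒m%n≡m s<h ⟨
    sum s % h  ≡⟨ %-cancel-+ h (sum s) 0 (sum y) (begin
      (sum s + sum y) % h  ≡⟨ cong (_% h) (+-comm (sum s) (sum y)) ⟩
      (sum y + sum s) % h  ≡⟨ cong (_% h) (sum-∸ s≤x) ⟩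
      sum x % h            ≡⟨ V-% x ⟨
      V x % h              ≡⟨ cong (_% h) eq ⟨
      V y % h              ≡⟨ V-% y ⟩
      sum y % h            ∎) ⟩
    0 % h      ≡⟨ 0%n≡0 ⟩
    0          ∎))
    where
    open ≡-Reasoning
    y : Vec ℕ n
    y = zipWith _∸_ x s
    0%n≡0 : 0 % h ≡ 0
    0%n≡0 = n<1⇒n≡0 (s≤s (m%n≤m 0 h))

  -- Heap `i` is to move to a `y` with `G i y ≡ b * h + e`; by the stair property `y` is then
  -- congruent to `e`. The last congruence says that the new sum is congruent to `k`, with
  -- `lookup x i` carried to the right to avoid subtraction.
  reach-single : ∀ x {k} i {b e} → b < lookup (A x) i → ⨁ (A x [ i ]≔ b) ≡ k / h →
                 e < h → (sum x + e) % h ≡ (k + lookup x i) % h →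
                 ¬ ¬ (∃[ y ] (x ⟶ y × V y ≡ k))
  reach-single x {k} i {b} {e} b<Aᵢ ⨁≡ e<h e≡ none =
    grundy-reach (G i) (G-grundy i) xᵢ target<G λ (y , (s , s∈S , s≤ , y≡) , Gy≡) →
      none (x [ i ]≔ y , single i s s∈S s≤ (cong (x [ i ]≔_) y≡) , divMod-injective h
        (begin
          V (x [ i ]≔ y) / h          ≡⟨ V-/ (x [ i ]≔ y) ⟩
          ⨁ (A (x [ i ]≔ y))          ≡⟨ cong ⨁ (A-update x i y) ⟩
          ⨁ (A x [ i ]≔ (G i y / h))  ≡⟨ cong (λ c → ⨁ (A x [ i ]≔ c))
                                              (trans (cong (_/ h) Gy≡) ([qh+r]/h h b e<h)) ⟩
          ⨁ (A x [ i ]≔ b)            ≡⟨ ⨁≡ ⟩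
          k / h                       ∎)
        (trans (V-% (x [ i ]≔ y)) (%-cancel-+ h (sum (x [ i ]≔ y)) k xᵢ (begin
          (sum (x [ i ]≔ y) + xᵢ) % h  ≡⟨ cong (_% h) (sum-update x i y) ⟩
          (sum x + y) % h              ≡⟨ cong (_% h) (+-comm (sum x) y) ⟩
          (y + sum x) % h              ≡⟨ %-cong-+ h y e (sum x) (y%≡ Gy≡) ⟩
          (e + sum x) % h              ≡⟨ cong (_% h) (+-comm e (sum x)) ⟩
          (sum x + e) % h              ≡⟨ e≡ ⟩
          (k + xᵢ) % h                 ∎))))
    where
    open ≡-Reasoning
    xᵢ : ℕ
    xᵢ = lookup x i

    y%≡ : ∀ {y} → G i y ≡ b * h + e → y % h ≡ e % h
    y%≡ {y} Gy≡ = trans (sym (stair-% h (a i) (G i) (stair i) y))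
      (trans (cong (_% h) Gy≡) (%-remove-+ˡ e (n∣m*n b)))

    target<G : b * h + e < G i xᵢ
    -- The chain is `b * h + e < suc b * h ≤ G i xᵢ / h * h ≤ G i xᵢ`.
    target<G = <-≤-trans (subst (b * h + e <_) (+-comm (b * h) h) (+-monoʳ-< (b * h) e<h))
      (≤-trans (*-monoˡ-≤ h (subst (b <_) (lookup∘tabulate _ i) b<Aᵢ)) (m/n*n≤m (G i xᵢ) h))

  -- The tokens taken are exactly the excess of the residue of the sum, a positive number below `h`,
  -- so the move is legal. No heap gives more than its own residue, so every quotient `G i / h`
  -- survives.
  reach-cyclic : ∀ x {k} s → ⨁ (A x) ≡ k / h → k % h < sum x % h →
                 Pointwise _≤_ s (Vec.map (_% h) x) → sum s ≡ sum x % h ∸ k % h →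
                 ∃[ y ] (x ⟶ y × V y ≡ k)
  reach-cyclic x {k} s A≡k/h k%h< s≤r sum-s≡ =
    y , cyclic s 0<s s<h s≤x refl , divMod-injective h
      (trans (V-/ y) (trans (cong ⨁ (tabulate-cong Aᵢ≡)) A≡k/h))
      (trans (V-% y) (%-cancel-+ h (sum y) k (sum s) (begin
        (sum y + sum s) % h                ≡⟨ cong (_% h) (sum-∸ s≤x) ⟩
        sum x % h                          ≡⟨ m%n%n≡m%n (sum x) h ⟨
        sum x % h % h                      ≡⟨ cong (_% h) (m+[n∸m]≡n (<⇒≤ k%h<)) ⟨
        (k % h + (sum x % h ∸ k % h)) % h  ≡⟨ cong (λ t → (k % h + t) % h) sum-s≡ ⟨
        (k % h + sum s) % h                ≡⟨ %-cong-+ h (k % h) k (sum s) (m%n%n≡m%n k h) ⟩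
        (k + sum s) % h                    ∎)))
    where
    open ≡-Reasoning
    y : Vec ℕ n
    y = zipWith _∸_ x s

    0<s : 0 < sum s
    0<s = subst (0 <_) (sym sum-s≡) (m<n⇒0<n∸m k%h<)

    s<h : sum s < h
    s<h = subst (_< h) (sym sum-s≡) (≤-<-trans (m∸n≤m _ (k % h)) (m%n<n (sum x) h))

    sᵢ≤ : ∀ i → lookup s i ≤ lookup x i % h
    sᵢ≤ i = subst (lookup s i ≤_) (lookup-map i (_% h) x) (Pointwise.lookup s≤r i)

    s≤x : Pointwise _≤_ s x
    s≤x = extensional⇒inductive (ext λ i → ≤-trans (sᵢ≤ i) (m%n≤m (lookup x i) h))

    Aᵢ≡ : ∀ i → G i (lookup y i) / h ≡ G i (lookup x i) / h
    Aᵢ≡ i = trans (cong (λ j → G i j / h) (lookup-zipWith _∸_ i x s))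
      (stair-remainder-∸ h (a i) (G i) (stair i) (lookup x i) (sᵢ≤ i))

  V-reach : ∀ x {k} → k < V x → ¬ ¬ (∃[ y ] (x ⟶ y × V y ≡ k))
  V-reach x {k} k<V with <-divMod-split h (⨁ (A x)) (m%n<n (sum x) h) k<V
  ... | inj₁ k/h<A
    with i , b , b<Aᵢ , ⨁≡ ← ⨁-option (A x) k/h<A
    -- `e` is the residue that heap `i` must have for the new sum to be congruent to `k`.
    with e , e<h , e≡ ← %-subtract h (k + lookup x i) (sum x) =
    reach-single x i b<Aᵢ ⨁≡ e<h e≡
  ... | inj₂ (k/h≡A , k%h<)
    with s , s≤r , sum-s≡ ← sum-choose (Vec.map (_% h) x) (sum x % h ∸ k % h)
                              (≤-trans (m∸n≤m _ (k % h)) (sum-%-≤ h x)) =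
    λ none → none (reach-cyclic x s (sym k/h≡A) k%h< s≤r sum-s≡)
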